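{- For every integer $r\geq 3$ there exist an $r$-connected $r$-regular graph $G$ of even order and a set $\mathcal O$ of pairwise vertex-disjoint odd cycles of $G$ with the following property: if $t$ is a positive integer and $F$ is a $t$-factor of $G$ with $E(F) \cap E(O) \neq \emptyset$ for every $O \in \mathcal{O}$, then $t \geq \frac{r}{3}$.
   Context: Graphs are finite and loopless. A cycle is a connected $2$-regular subgraph; it is odd if it has an odd number of edges. A $t$-factor of $G$ is a spanning $t$-regular subgraph. $r$-connected means $G$ has more than $r$ vertices and remains connected after deleting any fewer than $r$ vertices. -}

module Defs where

open import Data.Fin using (Fin; _≟_)
open import Data.Fin.Subset using (Subset; _∈_; _∉_; _∩_; ∁; ⊤; ∣_∣; Nonempty; Empty)
open import Data.Fin.Subset.Properties using (_∈?_; ∈⊤; x∉p⇒x∈∁p)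
open import Data.Bool using (true)
open import Data.Nat using (ℕ; _<_; _>_)
open import Data.Nat.Divisibility using (_∣_)
open import Data.Product using (_×_; _,_; proj₁; proj₂; ∃-syntax)
open import Data.Sum using (_⊎_)
open import Data.Vec using (tabulate)
open import Data.Vec.Properties using (lookup∘tabulate; []=⇒lookup)
open import Level using (Level)
open import Relation.Binary.Construct.Closure.ReflexiveTransitive using (Star)
open import Relation.Binary.PropositionalEquality using (_≡_; _≢_; sym; trans)
open import Relation.Nullary using (¬_; Dec; yes; no; does)
open import Relation.Nullary.Decidable using (_×-dec_; _⊎-dec_; ¬?)
open import Relation.Unary using (Pred; Decidable)

private variable
  ℓ : Level
  n : ℕ

comprehension : {P : Pred (Fin n) ℓ} → Decidable P → Subset n
comprehension P? = tabulate λ i → does (P? i)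

∈-comprehension⁻ : {P : Pred (Fin n) ℓ} (P? : Decidable P) →
                   ∀ {i} → i ∈ comprehension P? → P i
∈-comprehension⁻ {P = P} P? {i} i∈ =
  extract (P? i) (trans (sym (lookup∘tabulate _ i)) ([]=⇒lookup i∈))
  where
  extract : (d : Dec (P i)) → does d ≡ true → P i
  extract (yes p) _ = p
  extract (no _) ()

-- Parallel edges are allowed.  Edges are undirected: the order of the two
-- components of `ends e` carries no meaning.
record Graph : Set where
  field
    order    : ℕ
    size     : ℕ
    ends     : Fin size → Fin order × Fin order
    loopless : ∀ e → proj₁ (ends e) ≢ proj₂ (ends e)

  Vertex Edge : Set
  Vertex = Fin order
  Edge   = Fin size

  star : Vertex → Subset size
  star v = comprehension λ e → (v ≟ proj₁ (ends e)) ⊎-dec (v ≟ proj₂ (ends e))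

open Graph public

record Subgraph (G : Graph) : Set where
  field
    vertices : Subset (order G)
    edges    : Subset (size G)
    closed   : ∀ {e} → e ∈ edges →
               proj₁ (ends G e) ∈ vertices × proj₂ (ends G e) ∈ vertices

open Subgraph public

whole : (G : Graph) → Subgraph G
whole G = record { vertices = ⊤ ; edges = ⊤ ; closed = λ _ → ∈⊤ , ∈⊤ }

_∖_ : (G : Graph) → Subset (order G) → Subgraph G
G ∖ S = record
  { vertices = ∁ S
  ; edges    = comprehension avoids?
  ; closed   = λ e∈ → let (s∉ , t∉) = ∈-comprehension⁻ avoids? e∈
                      in x∉p⇒x∈∁p s∉ , x∉p⇒x∈∁p t∉
  }
  where
  avoids? : Decidable λ e → proj₁ (ends G e) ∉ S × proj₂ (ends G e) ∉ S
  avoids? e = ¬? (proj₁ (ends G e) ∈? S) ×-dec ¬? (proj₂ (ends G e) ∈? S)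

module _ {G : Graph} where

  degree : Subgraph G → Vertex G → ℕ
  degree H v = ∣ edges H ∩ star G v ∣

  Regular : ℕ → Subgraph G → Set
  Regular k H = ∀ {v} → v ∈ vertices H → degree H v ≡ k

  Adjacent : Subgraph G → Vertex G → Vertex G → Set
  Adjacent H u v = ∃[ e ] e ∈ edges H × (ends G e ≡ (u , v) ⊎ ends G e ≡ (v , u))

  Connected : Subgraph G → Set
  Connected H = Nonempty (vertices H) ×
    (∀ {u v} → u ∈ vertices H → v ∈ vertices H → Star (Adjacent H) u v)

  Cycle : Subgraph G → Set
  Cycle H = Connected H × Regular 2 H

  OddCycle : Subgraph G → Set
  OddCycle H = Cycle H × ¬ 2 ∣ ∣ edges H ∣

  Factor : ℕ → Subgraph G → Set
  Factor t H = vertices H ≡ ⊤ × Regular t H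

  VertexDisjoint : Subgraph G → Subgraph G → Set
  VertexDisjoint H K = Empty (vertices H ∩ vertices K)

  ShareEdge : Subgraph G → Subgraph G → Set
  ShareEdge H K = Nonempty (edges H ∩ edges K)

RegularGraph : ℕ → Graph → Set
RegularGraph r G = Regular r (whole G)

VertexConnected : ℕ → Graph → Set
VertexConnected r G = order G > r × (∀ S → ∣ S ∣ < r → Connected (G ∖ S))

{-# OPTIONS --safe #-}
module Submission where

-- Write r = m + 2.  Take three copies of K_{r,m}, the j-th with sides {x j i} and
-- {y j l}, and for every i add the triangle on x 0 i, x 1 i, x 2 i; the r triangles
-- form 𝒪.  If F is a t-factor, subtracting its degree sum over the y's from the one
-- over the x's cancels all edges outside the triangles: 3rt − 3mt = 6t is twice the
-- number of triangle edges of F, which is at least 2r when F meets every triangle.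
--
-- For r-connectivity, delete a set S of fewer than r vertices.  Some triangle avoids S
-- (colour x j i by i) and serves as a hub.  A surviving y j l is adjacent to it.
-- A surviving x j i reaches it through a surviving y j l, or, if S contains all of
-- those, through another copy: at most one vertex of S is left for the other two copies,
-- so one of them is intact.

open import Defs
open import Algebra.Properties.Semiring.Sum as Sum using ()
open import Data.Bool using (Bool; true; false; _∧_)
open import Data.Fin using (Fin; zero; suc; _≟_; _↑ˡ_; _↑ʳ_; combine; remQuot; splitAt)
open import Data.Fin.Patterns using (0F; 1F; 2F)
open import Data.Fin.Properties using (remQuot-combine; combine-remQuot; splitAt-↑ˡ; splitAt-↑ʳ; splitAt⁻¹-↑ˡ; splitAt⁻¹-↑ʳ; ¬∀⟶∃¬)
open import Data.Fin.Subset using (Subset; _∈_; _∉_; _∩_; _∪_; ⊤; ⊥; ⁅_⁆; ∣_∣)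
open import Data.Fin.Subset.Properties using (_∈?_; ∈⊤; x∉p⇒x∈∁p; x∈∁p⇒x∉p; x∈p∩q⁻; x∈p∪q⁺; x∈⁅x⁆; ∣⊥∣≡0; ∣⁅x⁆∣≡1; ∣⊤∣≡n; p⊆q⇒∣p∣≤∣q∣)
open import Data.List using (List; tabulate)
open import Data.List.Relation.Unary.All using (All)
open import Data.List.Relation.Unary.All.Properties as All using ()
open import Data.List.Relation.Unary.AllPairs using (AllPairs)
open import Data.List.Relation.Unary.AllPairs.Properties as AllPairs using ()
open import Data.Nat using (ℕ; zero; suc; _+_; _*_; _≤_; _<_; _≥_; z≤n; s≤s)
open import Data.Nat.Divisibility using (_∣_; _∣?_; divides)
open import Data.Nat.Properties hiding (_≟_)
open import Data.Nat.Tactic.RingSolver using (solve-∀)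
open import Data.Product using (Σ-syntax; ∃-syntax; _×_; _,_; proj₁; proj₂; map₂; uncurry)
open import Data.Sum using (_⊎_; inj₁; inj₂)
open import Data.Sum.Properties using (≡-dec; inj₁-injective; inj₂-injective)
open import Data.Product.Properties using (,-injectiveˡ; ,-injectiveʳ)
open import Data.Vec using (_∷_; []; lookup; there)
open import Data.Vec.Properties using (lookup∘tabulate; lookup-zipWith; lookup⇒[]=; []=⇒lookup)
open import Function using (_∘_; mk⇔; case_of_)
open import Relation.Binary.Construct.Closure.ReflexiveTransitive using (Star; ε; _◅_; _◅◅_; reverse)
open import Relation.Binary.PropositionalEquality
open import Relation.Nullary using (¬_; Dec; yes; no; does; contradiction)
open import Relation.Nullary.Decidable using (_×-dec_; _⊎-dec_; ¬?; does-⇔; from-no; dec-true; dec-false)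
open import Relation.Unary using (Pred; Decidable)

open Sum +-*-semiring using (sum; sum-syntax; sum-cong-≗; ∑-distrib-+; ∑-comm; *-distribʳ-sum; sum-replicate-zero)
open ≡-Reasoning

-- Indicator functions and finite sums.

χ : Bool → ℕ
χ true  = 1
χ false = 0

𝟙 : ∀ {p} {P : Set p} → Dec P → ℕ
𝟙 = χ ∘ does

𝟙-false : ∀ {p} {P : Set p} (P? : Dec P) → ¬ P → 𝟙 P? ≡ 0
𝟙-false P? ¬p = cong χ (dec-false P? ¬p)

𝟙-× : ∀ {p q} {P : Set p} {Q : Set q} (P? : Dec P) (Q? : Dec Q) →
      𝟙 (P? ×-dec Q?) ≡ 𝟙 P? * 𝟙 Q?
𝟙-× (yes _) Q? = sym (+-identityʳ (𝟙 Q?))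
𝟙-× (no _)  Q? = refl

𝟙-⊎ : ∀ {p q} {P : Set p} {Q : Set q} (P? : Dec P) (Q? : Dec Q) →
      ¬ (P × Q) → 𝟙 (P? ⊎-dec Q?) ≡ 𝟙 P? + 𝟙 Q?
𝟙-⊎ (yes p) (yes q) ¬pq = contradiction (p , q) ¬pq
𝟙-⊎ (yes _) (no _)  _   = refl
𝟙-⊎ (no _)  Q?      _   = refl

δ : ∀ {n} → Fin n → Fin n → ℕ
δ i j = 𝟙 (i ≟ j)

sum-zero : ∀ {n} {f : Fin n → ℕ} → (∀ i → f i ≡ 0) → sum f ≡ 0
sum-zero {n} f≡0 = trans (sum-cong-≗ f≡0) (sum-replicate-zero n)

sum-δ : ∀ {n} (f : Fin n → ℕ) (i : Fin n) → ∑[ j < n ] (f j * δ i j) ≡ f i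
sum-δ {suc n} f zero = begin
  f zero * 1 + ∑[ j < n ] (f (suc j) * 0) ≡⟨ cong₂ _+_ (*-identityʳ (f zero)) (sum-zero (*-zeroʳ ∘ f ∘ suc)) ⟩
  f zero + 0                            ≡⟨ +-identityʳ (f zero) ⟩
  f zero                                ∎
sum-δ {suc n} f (suc i) = cong₂ _+_ (*-zeroʳ (f zero)) (sum-δ (f ∘ suc) i)

sum-const : ∀ n c → ∑[ i < n ] c ≡ n * c
sum-const zero    c = refl
sum-const (suc n) c = cong (c +_) (sum-const n c)

sum-mono : ∀ {n} {f g : Fin n → ℕ} → (∀ i → f i ≤ g i) → sum f ≤ sum g
sum-mono {zero}  f≤g = z≤n
sum-mono {suc n} f≤g = +-mono-≤ (f≤g zero) (sum-mono (f≤g ∘ suc))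

term≤sum : ∀ {n} (f : Fin n → ℕ) i → f i ≤ sum f
term≤sum f zero    = m≤m+n _ _
term≤sum f (suc i) = ≤-trans (term≤sum (f ∘ suc) i) (m≤n+m _ _)

sum-splitAt : ∀ m {n} (f : Fin (m + n) → ℕ) →
              sum f ≡ ∑[ i < m ] f (i ↑ˡ n) + ∑[ j < n ] f (m ↑ʳ j)
sum-splitAt zero    f = refl
sum-splitAt (suc m) f =
  trans (cong (f zero +_) (sum-splitAt m (f ∘ suc))) (sym (+-assoc (f zero) _ _))

sum-combine : ∀ m {n} (f : Fin (m * n) → ℕ) →
              sum f ≡ ∑[ i < m ] ∑[ j < n ] f (combine i j)
sum-combine zero        f = refl
sum-combine (suc m) {n} f =
  trans (sum-splitAt n f) (cong (sum (λ j → f (j ↑ˡ m * n)) +_) (sum-combine m (f ∘ (n ↑ʳ_))))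

-- Cardinalities of subsets and the pigeonhole principle.

∣p∣≡sum : ∀ {n} (p : Subset n) → ∣ p ∣ ≡ ∑[ i < n ] χ (lookup p i)
∣p∣≡sum []          = refl
∣p∣≡sum (true  ∷ p) = cong suc (∣p∣≡sum p)
∣p∣≡sum (false ∷ p) = ∣p∣≡sum p

χ-∧ : ∀ a b → χ (a ∧ b) ≡ χ a * χ b
χ-∧ true  b = sym (+-identityʳ (χ b))
χ-∧ false b = refl

∣p∩q∣≡sum : ∀ {n} (p q : Subset n) → ∣ p ∩ q ∣ ≡ ∑[ i < n ] (χ (lookup p i) * χ (lookup q i))
∣p∩q∣≡sum p q = trans (∣p∣≡sum (p ∩ q)) (sum-cong-≗ λ i →
  trans (cong χ (lookup-zipWith _∧_ i p q)) (χ-∧ (lookup p i) (lookup q i)))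

module _ {n ℓ} {P : Pred (Fin n) ℓ} (P? : Decidable P) where

  lookup-comprehension : ∀ i → lookup (comprehension P?) i ≡ does (P? i)
  lookup-comprehension = lookup∘tabulate (does ∘ P?)

  ∈-comprehension⁺ : ∀ {i} → P i → i ∈ comprehension P?
  ∈-comprehension⁺ {i} p =
    lookup⇒[]= i _ (trans (lookup-comprehension i) (dec-true (P? i) p))

∣p∪q∣≤∣p∣+∣q∣ : ∀ {n} (p q : Subset n) → ∣ p ∪ q ∣ ≤ ∣ p ∣ + ∣ q ∣
∣p∪q∣≤∣p∣+∣q∣ []          []          = z≤n
∣p∪q∣≤∣p∣+∣q∣ (true  ∷ p) (true  ∷ q) =
  s≤s (≤-trans (∣p∪q∣≤∣p∣+∣q∣ p q) (+-monoʳ-≤ ∣ p ∣ (n≤1+n ∣ q ∣)))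
∣p∪q∣≤∣p∣+∣q∣ (true  ∷ p) (false ∷ q) = s≤s (∣p∪q∣≤∣p∣+∣q∣ p q)
∣p∪q∣≤∣p∣+∣q∣ (false ∷ p) (true  ∷ q) =
  ≤-trans (s≤s (∣p∪q∣≤∣p∣+∣q∣ p q)) (≤-reflexive (sym (+-suc ∣ p ∣ ∣ q ∣)))
∣p∪q∣≤∣p∣+∣q∣ (false ∷ p) (false ∷ q) = ∣p∪q∣≤∣p∣+∣q∣ p q

image : ∀ {n k} → (Fin n → Fin k) → Subset n → Subset k
image c []          = ⊥
image c (true  ∷ S) = ⁅ c zero ⁆ ∪ image (c ∘ suc) S
image c (false ∷ S) = image (c ∘ suc) S

-- Each member of `S` adds one singleton to the union, and cardinality is subadditive.
∣image∣≤ : ∀ {n k} (c : Fin n → Fin k) S → ∣ image c S ∣ ≤ ∣ S ∣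
∣image∣≤ {k = k} c [] = ≤-reflexive (∣⊥∣≡0 k)
∣image∣≤ c (true  ∷ S) = ≤-trans (∣p∪q∣≤∣p∣+∣q∣ ⁅ c zero ⁆ _)
  (+-mono-≤ (≤-reflexive (∣⁅x⁆∣≡1 (c zero))) (∣image∣≤ (c ∘ suc) S))
∣image∣≤ c (false ∷ S) = ∣image∣≤ (c ∘ suc) S

∈-image : ∀ {n k} (c : Fin n → Fin k) {S v} → v ∈ S → c v ∈ image c S
∈-image c {true  ∷ S} {zero}  v∈S = x∈p∪q⁺ (inj₁ (x∈⁅x⁆ (c zero)))
∈-image c {true  ∷ S} {suc v} (there v∈S) = x∈p∪q⁺ (inj₂ (∈-image (c ∘ suc) v∈S))
∈-image c {false ∷ S} {suc v} (there v∈S) = ∈-image (c ∘ suc) v∈S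

-- Pigeonhole: `S` meets at most `∣ S ∣` colours, so one of the `k` is missed. Both choices in the
-- connectivity proof, of an intact triangle and of a route, are instances for suitable colourings.
unusedColour : ∀ {n k} (c : Fin n → Fin k) S → ∣ S ∣ < k →
               ∃[ i ] (∀ {v} → c v ≡ i → v ∉ S)
unusedColour {k = k} c S ∣S∣<k =
  map₂ (λ i∉ cv≡i v∈S → i∉ (subst (_∈ image c S) cv≡i (∈-image c v∈S)))
       (¬∀⟶∃¬ k (_∈ image c S) (_∈? image c S) λ all∈ →
         <⇒≱ ∣S∣<k (≤-trans (≤-trans (≤-reflexive (sym (∣⊤∣≡n k)))
                               (p⊆q⇒∣p∣≤∣q∣ {p = ⊤} λ {i} _ → all∈ i))
                             (∣image∣≤ c S)))

-- Degrees and connectedness in an arbitrary graph.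

module _ {G : Graph} where

  -- The 0-1 characteristic function of the edge set, as a number so that degrees become sums whose
  -- order can be exchanged.
  multiplicity : Subgraph G → Edge G → ℕ
  multiplicity H e = χ (lookup (edges H) e)

  -- `star` is a disjunction over the two ends. Looplessness makes the disjuncts exclusive, so the
  -- indicator of the disjunction is a sum of two deltas.
  degree≡sum : (H : Subgraph G) (v : Vertex G) →
    degree H v ≡ ∑[ e < size G ] (multiplicity H e * (δ v (proj₁ (ends G e)) + δ v (proj₂ (ends G e))))
  degree≡sum H v = trans (∣p∩q∣≡sum (edges H) (star G v)) (sum-cong-≗ λ e →
    cong (multiplicity H e *_) (trans
      (cong χ (lookup∘tabulate _ e))
      (𝟙-⊎ (v ≟ proj₁ (ends G e)) (v ≟ proj₂ (ends G e))
        λ (v≡s , v≡t) → loopless G e (trans (sym v≡s) v≡t))))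

  multiplicity-∈ : (H : Subgraph G) {e : Edge G} → e ∈ edges H → multiplicity H e ≡ 1
  multiplicity-∈ H = cong χ ∘ []=⇒lookup

  Adjacent-sym : (H : Subgraph G) {u v : Vertex G} → Adjacent H u v → Adjacent H v u
  Adjacent-sym H (e , e∈ , inj₁ eq) = e , e∈ , inj₂ eq
  Adjacent-sym H (e , e∈ , inj₂ eq) = e , e∈ , inj₁ eq

  -- Two paths into a common hub join into one, the second being reversed by symmetry of adjacency.
  connected-via : (H : Subgraph G) (h : Vertex G) → h ∈ vertices H →
    (∀ {v} → v ∈ vertices H → Star (Adjacent H) v h) → Connected H
  connected-via H h h∈ path =
    (h , h∈) , λ u∈ v∈ → path u∈ ◅◅ reverse (Adjacent-sym H) (path v∈)

  ∖-adjacent : ∀ {S u v} e → ends G e ≡ (u , v) → u ∉ S → v ∉ S → Adjacent (G ∖ S) u v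
  ∖-adjacent {S} e refl u∉S v∉S =
    e , ∈-comprehension⁺ (λ e → ¬? (proj₁ (ends G e) ∈? S) ×-dec ¬? (proj₂ (ends G e) ∈? S))
                         (u∉S , v∉S) , inj₁ refl

-- The cyclic order on the three copies.

next prev : Fin 3 → Fin 3
next 0F = 1F
next 1F = 2F
next 2F = 0F
prev 0F = 2F
prev 1F = 0F
prev 2F = 1F

next-prev : ∀ j → next (prev j) ≡ j
next-prev 0F = refl
next-prev 1F = refl
next-prev 2F = refl

j≢next : ∀ j → j ≢ next j
j≢next 0F ()
j≢next 1F ()
j≢next 2F ()

sum-prev : ∀ (f : Fin 3 → ℕ) → sum (f ∘ prev) ≡ sum f
sum-prev f = lemma (f 0F) (f 1F) (f 2F)
  where
  lemma : ∀ a b c → c + (a + (b + 0)) ≡ a + (b + (c + 0))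
  lemma = solve-∀

-- Reindexing along the permutation `prev` turns `next j` into `j`. This isolates the triangle edge
-- that arrives at a vertex from the preceding copy.
sum-δ-next : ∀ (f : Fin 3 → ℕ) i → ∑[ j < 3 ] (f j * δ i (next j)) ≡ f (prev i)
sum-δ-next f i = begin
  ∑[ j < 3 ] (f j * δ i (next j))               ≡⟨ sum-prev (λ j → f j * δ i (next j)) ⟨
  ∑[ j < 3 ] (f (prev j) * δ i (next (prev j))) ≡⟨ sum-cong-≗ (λ j → cong (λ j′ → f (prev j) * δ i j′) (next-prev j)) ⟩
  ∑[ j < 3 ] (f (prev j) * δ i j)               ≡⟨ sum-δ (f ∘ prev) i ⟩
  f (prev i)                                  ∎

-- The graph: vertices, edges and their codes.

module Construction (r m : ℕ) where

  V E : Set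
  V = Fin (3 * (r + m))
  E = Fin (3 * (r * m + r))

  x : Fin 3 → Fin r → V
  x j i = combine j (i ↑ˡ m)

  y : Fin 3 → Fin m → V
  y j l = combine j (r ↑ʳ l)

  decodeV : V → Fin 3 × (Fin r ⊎ Fin m)
  decodeV = map₂ (splitAt r) ∘ remQuot (r + m)

  decodeV-x : ∀ j i → decodeV (x j i) ≡ (j , inj₁ i)
  decodeV-x j i = begin
    decodeV (x j i)              ≡⟨ cong (map₂ (splitAt r)) (remQuot-combine j (i ↑ˡ m)) ⟩
    (j , splitAt r (i ↑ˡ m))     ≡⟨ cong (j ,_) (splitAt-↑ˡ r i m) ⟩
    (j , inj₁ i)                 ∎

  decodeV-y : ∀ j l → decodeV (y j l) ≡ (j , inj₂ l)
  decodeV-y j l = begin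
    decodeV (y j l)              ≡⟨ cong (map₂ (splitAt r)) (remQuot-combine j (r ↑ʳ l)) ⟩
    (j , splitAt r (r ↑ʳ l))     ≡⟨ cong (j ,_) (splitAt-↑ʳ r m l) ⟩
    (j , inj₂ l)                 ∎

  -- Vertices are bare numbers; the view restores case distinction by side and copy.
  data ViewV : V → Set where
    isX : ∀ j i → ViewV (x j i)
    isY : ∀ j l → ViewV (y j l)

  viewV : ∀ v → ViewV v
  viewV v = subst ViewV (combine-remQuot {3} (r + m) v) (view (remQuot (r + m) v))
    where
    view : (p : Fin 3 × Fin (r + m)) → ViewV (uncurry combine p)
    view (j , w) with splitAt r w in eq
    ... | inj₁ i = subst (ViewV ∘ combine j) (splitAt⁻¹-↑ˡ eq) (isX j i)
    ... | inj₂ l = subst (ViewV ∘ combine j) (splitAt⁻¹-↑ʳ eq) (isY j l)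

  xy : Fin 3 → Fin r → Fin m → E
  xy j i l = combine j (combine i l ↑ˡ r)

  xx : Fin 3 → Fin r → E
  xx j i = combine j ((r * m) ↑ʳ i)

  decodeE : E → Fin 3 × (Fin (r * m) ⊎ Fin r)
  decodeE = map₂ (splitAt (r * m)) ∘ remQuot (r * m + r)

  -- A triangle edge is indexed by the copy from which it leads to the next one in cyclic order.
  -- Thus each is listed once, and the two at `x j i` are `xx j i` and `xx (prev j) i`.
  endsOf : Fin 3 × (Fin (r * m) ⊎ Fin r) → V × V
  endsOf (j , inj₁ p) = x j (proj₁ (remQuot {r} m p)) , y j (proj₂ (remQuot {r} m p))
  endsOf (j , inj₂ i) = x j i , x (next j) i

  decodeE-xy : ∀ j i l → decodeE (xy j i l) ≡ (j , inj₁ (combine i l))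
  decodeE-xy j i l = begin
    decodeE (xy j i l)
      ≡⟨ cong (map₂ (splitAt (r * m))) (remQuot-combine j (combine i l ↑ˡ r)) ⟩
    (j , splitAt (r * m) (combine i l ↑ˡ r))
      ≡⟨ cong (j ,_) (splitAt-↑ˡ (r * m) (combine i l) r) ⟩
    (j , inj₁ (combine i l)) ∎

  decodeE-xx : ∀ j i → decodeE (xx j i) ≡ (j , inj₂ i)
  decodeE-xx j i = begin
    decodeE (xx j i)
      ≡⟨ cong (map₂ (splitAt (r * m))) (remQuot-combine j ((r * m) ↑ʳ i)) ⟩
    (j , splitAt (r * m) ((r * m) ↑ʳ i))
      ≡⟨ cong (j ,_) (splitAt-↑ʳ (r * m) r i) ⟩
    (j , inj₂ i) ∎

  encode-decodeE : ∀ e {j i} → decodeE e ≡ (j , inj₂ i) → e ≡ xx j i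
  encode-decodeE e {j} {i} eq = begin
    e                    ≡⟨ combine-remQuot {3} (r * m + r) e ⟨
    uncurry combine p    ≡⟨ cong₂ combine (,-injectiveˡ eq) (sym (splitAt⁻¹-↑ʳ (,-injectiveʳ eq))) ⟩
    xx j i               ∎
    where p = remQuot {3} (r * m + r) e

  x-injective : ∀ {j i j′ i′} → x j i ≡ x j′ i′ → j ≡ j′ × i ≡ i′
  x-injective {j} {i} {j′} {i′} eq = ,-injectiveˡ eq′ , inj₁-injective (,-injectiveʳ eq′)
    where eq′ = trans (sym (decodeV-x j i)) (trans (cong decodeV eq) (decodeV-x j′ i′))

  y-injective : ∀ {j l j′ l′} → y j l ≡ y j′ l′ → j ≡ j′ × l ≡ l′
  y-injective {j} {l} {j′} {l′} eq = ,-injectiveˡ eq′ , inj₂-injective (,-injectiveʳ eq′)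
    where eq′ = trans (sym (decodeV-y j l)) (trans (cong decodeV eq) (decodeV-y j′ l′))

  x≢y : ∀ j i j′ l → x j i ≢ y j′ l
  x≢y j i j′ l eq
    with () ← trans (sym (decodeV-x j i)) (trans (cong decodeV eq) (decodeV-y j′ l))

  G : Graph
  G = record
    { order    = 3 * (r + m)
    ; size     = 3 * (r * m + r)
    ; ends     = endsOf ∘ decodeE
    ; loopless = distinct ∘ decodeE
    }
    where
    distinct : ∀ c → proj₁ (endsOf c) ≢ proj₂ (endsOf c)
    distinct (j , inj₁ p) = x≢y j (proj₁ (remQuot {r} m p)) j (proj₂ (remQuot {r} m p))
    distinct (j , inj₂ _) = j≢next j ∘ proj₁ ∘ x-injective

  ends-xy : ∀ j i l → ends G (xy j i l) ≡ (x j i , y j l)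
  ends-xy j i l = trans (cong endsOf (decodeE-xy j i l))
                        (cong (λ (i , l) → x j i , y j l) (remQuot-combine i l))

  ends-xx : ∀ j i → ends G (xx j i) ≡ (x j i , x (next j) i)
  ends-xx j i = cong endsOf (decodeE-xx j i)

  -- Degrees as sums over edges.

  δ-xx : ∀ j i j′ i′ → δ (x j i) (x j′ i′) ≡ δ i i′ * δ j j′
  δ-xx j i j′ i′ = trans
    (cong χ (does-⇔ (mk⇔ (λ eq → let j≡ , i≡ = x-injective eq in i≡ , j≡)
                          (λ (i≡ , j≡) → cong₂ x j≡ i≡))
                    (x j i ≟ x j′ i′) ((i ≟ i′) ×-dec (j ≟ j′))))
    (𝟙-× (i ≟ i′) (j ≟ j′))

  δ-yy : ∀ j l j′ l′ → δ (y j l) (y j′ l′) ≡ δ l l′ * δ j j′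
  δ-yy j l j′ l′ = trans
    (cong χ (does-⇔ (mk⇔ (λ eq → let j≡ , l≡ = y-injective eq in l≡ , j≡)
                          (λ (l≡ , j≡) → cong₂ y j≡ l≡))
                    (y j l ≟ y j′ l′) ((l ≟ l′) ×-dec (j ≟ j′))))
    (𝟙-× (l ≟ l′) (j ≟ j′))

  δ-xy : ∀ j i j′ l → δ (x j i) (y j′ l) ≡ 0
  δ-xy j i j′ l = 𝟙-false (x j i ≟ y j′ l) (x≢y j i j′ l)

  δ-yx : ∀ j l j′ i → δ (y j l) (x j′ i) ≡ 0
  δ-yx j l j′ i = 𝟙-false (y j l ≟ x j′ i) (x≢y j′ i j l ∘ sym)

  sum-edges : (f : E → ℕ) →
    sum f ≡ ∑[ j < 3 ] ((∑[ i < r ] ∑[ l < m ] f (xy j i l)) + ∑[ i < r ] f (xx j i))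
  sum-edges f = trans (sum-combine 3 {r * m + r} f) (sum-cong-≗ λ j →
    trans (sum-splitAt (r * m) (λ w → f (combine j w)))
          (cong (_+ ∑[ i < r ] f (xx j i)) (sum-combine r (λ w → f (combine j (w ↑ˡ r))))))

  module _ (H : Subgraph G) where

    private
      μ : E → ℕ
      μ = multiplicity H

      incidences : V → E → ℕ
      incidences v e = δ v (proj₁ (ends G e)) + δ v (proj₂ (ends G e))

      incidences-xy : ∀ v j i l → incidences v (xy j i l) ≡ δ v (x j i) + δ v (y j l)
      incidences-xy v j i l = cong (λ (s , t) → δ v s + δ v t) (ends-xy j i l)

      incidences-xx : ∀ v j i → incidences v (xx j i) ≡ δ v (x j i) + δ v (x (next j) i)
      incidences-xx v j i = cong (λ (s , t) → δ v s + δ v t) (ends-xx j i)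

    -- Besides its edges to the `y j l`, the vertex has one triangle edge leaving for the next copy
    -- and one arriving from the previous copy.
    degree-x : ∀ j i → degree H (x j i) ≡
               ∑[ l < m ] μ (xy j i l) + (μ (xx j i) + μ (xx (prev j) i))
    degree-x j₀ i₀ = begin
      degree H v
        ≡⟨ degree≡sum H v ⟩
      ∑[ e < size G ] (μ e * incidences v e)
        ≡⟨ sum-edges (λ e → μ e * incidences v e) ⟩
      ∑[ j < 3 ] (∑[ i < r ] ∑[ l < m ] (μ (xy j i l) * incidences v (xy j i l)) +
                  ∑[ i < r ] (μ (xx j i) * incidences v (xx j i)))
        ≡⟨ sum-cong-≗ (λ j → cong₂ _+_ (bipartite j) (triangles j)) ⟩
      ∑[ j < 3 ] (B j * δ j₀ j + (T j * δ j₀ j + T j * δ j₀ (next j)))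
        ≡⟨ ∑-distrib-+ (λ j → B j * δ j₀ j) (λ j → T j * δ j₀ j + T j * δ j₀ (next j)) ⟩
      ∑[ j < 3 ] (B j * δ j₀ j) + ∑[ j < 3 ] (T j * δ j₀ j + T j * δ j₀ (next j))
        ≡⟨ cong₂ _+_ (sum-δ B j₀) (∑-distrib-+ (λ j → T j * δ j₀ j) (λ j → T j * δ j₀ (next j))) ⟩
      B j₀ + (∑[ j < 3 ] (T j * δ j₀ j) + ∑[ j < 3 ] (T j * δ j₀ (next j)))
        ≡⟨ cong (B j₀ +_) (cong₂ _+_ (sum-δ T j₀) (sum-δ-next T j₀)) ⟩
      B j₀ + (T j₀ + T (prev j₀)) ∎
      where
      v = x j₀ i₀
      B T : Fin 3 → ℕ
      B j = ∑[ l < m ] μ (xy j i₀ l)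
      T j = μ (xx j i₀)

      -- Collapses the sum over `i` and leaves the condition on the copy as the constant `c`; `δ-xx`
      -- puts the factor for `i` first to fit this form.
      pick : ∀ (f : Fin r → ℕ) c → ∑[ i < r ] (f i * (δ i₀ i * c)) ≡ f i₀ * c
      pick f c = begin
        ∑[ i < r ] (f i * (δ i₀ i * c)) ≡⟨ sum-cong-≗ (λ i → *-assoc (f i) (δ i₀ i) c) ⟨
        ∑[ i < r ] (f i * δ i₀ i * c)   ≡⟨ *-distribʳ-sum c (λ i → f i * δ i₀ i) ⟨
        ∑[ i < r ] (f i * δ i₀ i) * c   ≡⟨ cong (_* c) (sum-δ f i₀) ⟩
        f i₀ * c                        ∎

      bipartite : ∀ j → ∑[ i < r ] ∑[ l < m ] (μ (xy j i l) * incidences v (xy j i l)) ≡ B j * δ j₀ j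
      bipartite j = begin
        ∑[ i < r ] ∑[ l < m ] (μ (xy j i l) * incidences v (xy j i l))
          ≡⟨ sum-cong-≗ (λ i → sum-cong-≗ λ l → cong (μ (xy j i l) *_) (trans
               (incidences-xy v j i l)
               (trans (cong₂ _+_ (δ-xx j₀ i₀ j i) (δ-xy j₀ i₀ j l)) (+-identityʳ _)))) ⟩
        ∑[ i < r ] ∑[ l < m ] (μ (xy j i l) * (δ i₀ i * δ j₀ j))
          ≡⟨ sum-cong-≗ (λ i → *-distribʳ-sum (δ i₀ i * δ j₀ j) (λ l → μ (xy j i l))) ⟨
        ∑[ i < r ] (∑[ l < m ] μ (xy j i l) * (δ i₀ i * δ j₀ j))
          ≡⟨ pick (λ i → ∑[ l < m ] μ (xy j i l)) (δ j₀ j) ⟩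
        B j * δ j₀ j ∎

      triangles : ∀ j → ∑[ i < r ] (μ (xx j i) * incidences v (xx j i)) ≡ T j * δ j₀ j + T j * δ j₀ (next j)
      triangles j = begin
        ∑[ i < r ] (μ (xx j i) * incidences v (xx j i))
          ≡⟨ sum-cong-≗ (λ i → cong (μ (xx j i) *_) (trans
               (incidences-xx v j i)
               (cong₂ _+_ (δ-xx j₀ i₀ j i) (δ-xx j₀ i₀ (next j) i)))) ⟩
        ∑[ i < r ] (μ (xx j i) * (δ i₀ i * δ j₀ j + δ i₀ i * δ j₀ (next j)))
          -- Both ends of `xx j i` have the same index `i`, so `pick` can treat them together, with
          -- the sum of their copy factors as its constant.
          ≡⟨ sum-cong-≗ (λ i → cong (μ (xx j i) *_) (*-distribˡ-+ (δ i₀ i) (δ j₀ j) (δ j₀ (next j)))) ⟨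
        ∑[ i < r ] (μ (xx j i) * (δ i₀ i * (δ j₀ j + δ j₀ (next j))))
          ≡⟨ pick (λ i → μ (xx j i)) (δ j₀ j + δ j₀ (next j)) ⟩
        T j * (δ j₀ j + δ j₀ (next j))
          ≡⟨ *-distribˡ-+ (T j) (δ j₀ j) (δ j₀ (next j)) ⟩
        T j * δ j₀ j + T j * δ j₀ (next j) ∎

    -- Triangle edges join only `x`-vertices, so just the edges of the complete bipartite copy
    -- contribute.
    degree-y : ∀ j l → degree H (y j l) ≡ ∑[ i < r ] μ (xy j i l)
    degree-y j₀ l₀ = begin
      degree H v
        ≡⟨ degree≡sum H v ⟩
      ∑[ e < size G ] (μ e * incidences v e)
        ≡⟨ sum-edges (λ e → μ e * incidences v e) ⟩
      ∑[ j < 3 ] (∑[ i < r ] ∑[ l < m ] (μ (xy j i l) * incidences v (xy j i l)) +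
                  ∑[ i < r ] (μ (xx j i) * incidences v (xx j i)))
        ≡⟨ sum-cong-≗ (λ j → trans (cong₂ _+_ (bipartite j) (triangles j)) (+-identityʳ _)) ⟩
      ∑[ j < 3 ] (B j * δ j₀ j)
        ≡⟨ sum-δ B j₀ ⟩
      B j₀ ∎
      where
      v = y j₀ l₀
      B : Fin 3 → ℕ
      B j = ∑[ i < r ] μ (xy j i l₀)

      bipartite : ∀ j → ∑[ i < r ] ∑[ l < m ] (μ (xy j i l) * incidences v (xy j i l)) ≡ B j * δ j₀ j
      bipartite j = begin
        ∑[ i < r ] ∑[ l < m ] (μ (xy j i l) * incidences v (xy j i l))
          ≡⟨ sum-cong-≗ (λ i → sum-cong-≗ λ l → cong (μ (xy j i l) *_) (trans
               (incidences-xy v j i l)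
               (cong₂ _+_ (δ-yx j₀ l₀ j i) (δ-yy j₀ l₀ j l)))) ⟩
        ∑[ i < r ] ∑[ l < m ] (μ (xy j i l) * (δ l₀ l * δ j₀ j))
          ≡⟨ sum-cong-≗ (λ i → sum-cong-≗ λ l → *-assoc (μ (xy j i l)) (δ l₀ l) (δ j₀ j)) ⟨
        ∑[ i < r ] ∑[ l < m ] (μ (xy j i l) * δ l₀ l * δ j₀ j)
          ≡⟨ sum-cong-≗ (λ i → *-distribʳ-sum (δ j₀ j) (λ l → μ (xy j i l) * δ l₀ l)) ⟨
        ∑[ i < r ] (∑[ l < m ] (μ (xy j i l) * δ l₀ l) * δ j₀ j)
          ≡⟨ sum-cong-≗ (λ i → cong (_* δ j₀ j) (sum-δ (λ l → μ (xy j i l)) l₀)) ⟩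
        ∑[ i < r ] (μ (xy j i l₀) * δ j₀ j)
          ≡⟨ *-distribʳ-sum (δ j₀ j) (λ i → μ (xy j i l₀)) ⟨
        B j * δ j₀ j ∎

      triangles : ∀ j → ∑[ i < r ] (μ (xx j i) * incidences v (xx j i)) ≡ 0
      triangles j = sum-zero λ i → trans
        (cong (μ (xx j i) *_) (trans (incidences-xx v j i)
          (cong₂ _+_ (δ-yx j₀ l₀ j i) (δ-yx j₀ l₀ (next j) i))))
        (*-zeroʳ (μ (xx j i)))

  -- The triangles as disjoint odd cycles.

  triangle : Fin r → Subgraph G
  triangle i = record
    { vertices = comprehension inTriangleV?
    ; edges    = comprehension inTriangleE?
    ; closed   = λ {e} e∈ → closed′ (∈-comprehension⁻ inTriangleE? {e} e∈)
    }
    module Triangle where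
    -- Membership is read off the code with the copy number dropped, which admits exactly the three
    -- vertices `x j i`; likewise for the edges.
    inTriangleV? : Decidable λ v → proj₂ (decodeV v) ≡ inj₁ i
    inTriangleV? v = ≡-dec _≟_ _≟_ (proj₂ (decodeV v)) (inj₁ i)

    inTriangleE? : Decidable λ e → proj₂ (decodeE e) ≡ inj₂ i
    inTriangleE? e = ≡-dec _≟_ _≟_ (proj₂ (decodeE e)) (inj₂ i)

    x∈ : ∀ j → x j i ∈ comprehension inTriangleV?
    x∈ j = ∈-comprehension⁺ inTriangleV? (cong proj₂ (decodeV-x j i))

    closed′ : ∀ {c} → proj₂ c ≡ inj₂ i →
              proj₁ (endsOf c) ∈ comprehension inTriangleV? ×
              proj₂ (endsOf c) ∈ comprehension inTriangleV?
    closed′ {j , _} refl = x∈ j , x∈ (next j)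

  module _ (i : Fin r) where
    open Triangle i

    ∈-triangleV : ∀ {v} → v ∈ vertices (triangle i) → ∃[ j ] v ≡ x j i
    ∈-triangleV {v} v∈ with viewV v
    ... | isX j i′ = j , cong (x j) (inj₁-injective
          (trans (sym (cong proj₂ (decodeV-x j i′))) (∈-comprehension⁻ inTriangleV? v∈)))
    ... | isY j l
        with () ← trans (sym (cong proj₂ (decodeV-y j l))) (∈-comprehension⁻ inTriangleV? v∈)

    ∈-triangleE : ∀ {e} → e ∈ edges (triangle i) → ∃[ j ] e ≡ xx j i
    ∈-triangleE {e} e∈ = proj₁ (decodeE e) , encode-decodeE e
      (cong (proj₁ (decodeE e) ,_) (∈-comprehension⁻ inTriangleE? {e} e∈))

    xx∈triangle : ∀ j → xx j i ∈ edges (triangle i)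
    xx∈triangle j = ∈-comprehension⁺ inTriangleE? (cong proj₂ (decodeE-xx j i))

    multiplicity-triangle-xy : ∀ j i′ l → multiplicity (triangle i) (xy j i′ l) ≡ 0
    multiplicity-triangle-xy j i′ l =
      trans (cong χ (lookup-comprehension inTriangleE? (xy j i′ l)))
            (𝟙-false (inTriangleE? (xy j i′ l)) λ eq →
              case trans (sym (cong proj₂ (decodeE-xy j i′ l))) eq of λ ())

    multiplicity-triangle-xx : ∀ j i′ → multiplicity (triangle i) (xx j i′) ≡ δ i i′
    multiplicity-triangle-xx j i′ =
      cong χ (trans (lookup-comprehension inTriangleE? (xx j i′))
        (does-⇔ (mk⇔ (λ eq → sym (inj₂-injective (trans (sym eq′) eq))) (trans eq′ ∘ cong inj₂ ∘ sym))
                (inTriangleE? (xx j i′)) (i ≟ i′)))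
      where eq′ = cong proj₂ (decodeE-xx j i′)

    triangle-connected : Connected (triangle i)
    triangle-connected = connected-via (triangle i) (x 0F i) (x∈ 0F) λ v∈ → path (∈-triangleV v∈)
      where
      path : ∀ {v} → ∃[ j ] v ≡ x j i → Star (Adjacent (triangle i)) v (x 0F i)
      path (0F , refl) = ε
      path (1F , refl) = (xx 0F i , xx∈triangle 0F , inj₂ (ends-xx 0F i)) ◅ ε
      path (2F , refl) = (xx 2F i , xx∈triangle 2F , inj₁ (ends-xx 2F i)) ◅ ε

    triangle-2-regular : Regular 2 (triangle i)
    triangle-2-regular v∈ with j , refl ← ∈-triangleV v∈ = begin
      degree T (x j i)
        ≡⟨ degree-x T j i ⟩
      ∑[ l < m ] multiplicity T (xy j i l) + (multiplicity T (xx j i) + multiplicity T (xx (prev j) i))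
        ≡⟨ cong₂ _+_ (sum-zero (multiplicity-triangle-xy j i))
                     (cong₂ _+_ (multiplicity-∈ T (xx∈triangle j)) (multiplicity-∈ T (xx∈triangle (prev j)))) ⟩
      2 ∎
      where T = triangle i

    triangle-size : ∣ edges (triangle i) ∣ ≡ 3
    triangle-size = begin
      ∣ edges T ∣
        ≡⟨ ∣p∣≡sum (edges T) ⟩
      sum (multiplicity T)
        ≡⟨ sum-edges (multiplicity T) ⟩
      ∑[ j < 3 ] (∑[ i′ < r ] ∑[ l < m ] multiplicity T (xy j i′ l) + ∑[ i′ < r ] multiplicity T (xx j i′))
        ≡⟨ sum-cong-≗ (λ j → cong₂ _+_
             (sum-zero λ i′ → sum-zero (multiplicity-triangle-xy j i′))
             -- The factor 1 brings the summand into the shape of `sum-δ`; each of the three copies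
             -- then contributes one edge.
             (trans (sum-cong-≗ λ i′ → trans (multiplicity-triangle-xx j i′) (sym (*-identityˡ _)))
                    (sum-δ (λ _ → 1) i))) ⟩
      3 ∎
      where T = triangle i

    triangle-odd : OddCycle (triangle i)
    triangle-odd = (triangle-connected , λ {v} → triangle-2-regular {v})
                 , subst (λ n → ¬ 2 ∣ n) (sym triangle-size) (from-no (2 ∣? 3))

  triangles-disjoint : ∀ {i i′} → i ≢ i′ → VertexDisjoint (triangle i) (triangle i′)
  triangles-disjoint {i} {i′} i≢i′ (v , v∈) =
    let v∈i , v∈i′ = x∈p∩q⁻ (vertices (triangle i)) _ v∈
        j  , v≡x   = ∈-triangleV i v∈i
        j′ , v≡x′  = ∈-triangleV i′ v∈i′
    in i≢i′ (proj₂ (x-injective {j} {i} {j′} {i′} (trans (sym v≡x) v≡x′)))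

  triangles : List (Subgraph G)
  triangles = tabulate triangle

  triangles-odd : All OddCycle triangles
  triangles-odd = All.tabulate⁺ triangle-odd

  triangles-pairwise-disjoint : AllPairs VertexDisjoint triangles
  triangles-pairwise-disjoint = AllPairs.tabulate⁺ triangles-disjoint

  multiplicity-whole : ∀ e → multiplicity (whole G) e ≡ 1
  multiplicity-whole e = multiplicity-∈ (whole G) ∈⊤

  -- Regularity and parity of the order.

  regular : r ≡ 2 + m → RegularGraph r G
  regular r≡2+m {v} _ with viewV v
  ... | isX j i = begin
    degree (whole G) (x j i)
      ≡⟨ degree-x (whole G) j i ⟩
    ∑[ l < m ] multiplicity (whole G) (xy j i l) +
    (multiplicity (whole G) (xx j i) + multiplicity (whole G) (xx (prev j) i))
      ≡⟨ cong₂ _+_ (sum-cong-≗ λ l → multiplicity-whole (xy j i l))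
                   (cong₂ _+_ (multiplicity-whole (xx j i)) (multiplicity-whole (xx (prev j) i))) ⟩
    ∑[ l < m ] 1 + 2
      ≡⟨ cong (_+ 2) (trans (sum-const m 1) (*-identityʳ m)) ⟩
    m + 2
      ≡⟨ +-comm m 2 ⟩
    2 + m
      ≡⟨ r≡2+m ⟨
    r ∎
  ... | isY j l = begin
    degree (whole G) (y j l)                     ≡⟨ degree-y (whole G) j l ⟩
    ∑[ i < r ] multiplicity (whole G) (xy j i l) ≡⟨ sum-cong-≗ (λ i → multiplicity-whole (xy j i l)) ⟩
    ∑[ i < r ] 1                                 ≡⟨ trans (sum-const r 1) (*-identityʳ r) ⟩
    r                                            ∎

  order-even : r ≡ 2 + m → 2 ∣ order G
  order-even refl = divides (3 * (1 + m)) (lemma m)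
    where
    lemma : ∀ m → 3 * (2 + m + m) ≡ 3 * (1 + m) * 2
    lemma = solve-∀

  -- Degree sums of a factor.

  module _ (r≡2+m : r ≡ 2 + m) (t : ℕ) (F : Subgraph G) (factor : Factor t F)
           (hits : All (ShareEdge F) triangles) where

    private
      μ : E → ℕ
      μ = multiplicity F

      bipartite triangular : ℕ
      bipartite  = ∑[ j < 3 ] ∑[ i < r ] ∑[ l < m ] μ (xy j i l)
      triangular = ∑[ j < 3 ] ∑[ i < r ] μ (xx j i)

      degree-F : ∀ v → degree F v ≡ t
      degree-F v = proj₂ factor (subst (v ∈_) (sym (proj₁ factor)) ∈⊤)

    -- A bipartite edge has one end among the `x`-vertices, a triangle edge has two.
    x-degree-sum : 3 * (r * t) ≡ bipartite + (triangular + triangular)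
    x-degree-sum = begin
      3 * (r * t)
        ≡⟨ trans (sum-cong-≗ {3} λ _ → sum-const r t) (sum-const 3 (r * t)) ⟨
      ∑[ j < 3 ] ∑[ i < r ] t
        ≡⟨ sum-cong-≗ (λ j → sum-cong-≗ λ i → trans (sym (degree-F (x j i))) (degree-x F j i)) ⟩
      ∑[ j < 3 ] ∑[ i < r ] (∑[ l < m ] μ (xy j i l) + (μ (xx j i) + μ (xx (prev j) i)))
        ≡⟨ sum-cong-≗ (λ j → trans
             (∑-distrib-+ (λ i → ∑[ l < m ] μ (xy j i l)) (λ i → μ (xx j i) + μ (xx (prev j) i)))
             (cong (∑[ i < r ] ∑[ l < m ] μ (xy j i l) +_)
                   (∑-distrib-+ (λ i → μ (xx j i)) (λ i → μ (xx (prev j) i))))) ⟩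
      ∑[ j < 3 ] (∑[ i < r ] ∑[ l < m ] μ (xy j i l) + (T j + T (prev j)))
        ≡⟨ ∑-distrib-+ (λ j → ∑[ i < r ] ∑[ l < m ] μ (xy j i l)) (λ j → T j + T (prev j)) ⟩
      bipartite + ∑[ j < 3 ] (T j + T (prev j))
        ≡⟨ cong (bipartite +_) (∑-distrib-+ T (T ∘ prev)) ⟩
      bipartite + (triangular + sum (T ∘ prev))
        -- The arriving triangle edges are the leaving ones, with the copies permuted by `prev`.
        ≡⟨ cong (λ s → bipartite + (triangular + s)) (sum-prev T) ⟩
      bipartite + (triangular + triangular) ∎
      where
      T : Fin 3 → ℕ
      T j = ∑[ i < r ] μ (xx j i)

    -- Every bipartite edge has exactly one end among the `y`-vertices, and no triangle edge has
    -- any.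
    y-degree-sum : 3 * (m * t) ≡ bipartite
    y-degree-sum = begin
      3 * (m * t)
        ≡⟨ trans (sum-cong-≗ {3} λ _ → sum-const m t) (sum-const 3 (m * t)) ⟨
      ∑[ j < 3 ] ∑[ l < m ] t
        ≡⟨ sum-cong-≗ (λ j → sum-cong-≗ λ l → trans (sym (degree-F (y j l))) (degree-y F j l)) ⟩
      ∑[ j < 3 ] ∑[ l < m ] ∑[ i < r ] μ (xy j i l)
        ≡⟨ sum-cong-≗ (λ j → ∑-comm (λ l i → μ (xy j i l))) ⟩
      bipartite ∎

    -- The difference of the two degree sums, written with cancellation in place of subtraction: the
    -- sides differ by `r - m = 2` vertices per copy, which leaves `6t` for twice `triangular`.
    triangular≡3t : triangular ≡ 3 * t
    triangular≡3t = *-cancelˡ-≡ triangular (3 * t) 2 (+-cancelˡ-≡ bipartite _ _ (begin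
      bipartite + 2 * triangular            ≡⟨ cong (λ s → bipartite + (triangular + s)) (+-identityʳ triangular) ⟩
      bipartite + (triangular + triangular) ≡⟨ x-degree-sum ⟨
      3 * (r * t)                           ≡⟨ cong (λ r → 3 * (r * t)) r≡2+m ⟩
      3 * ((2 + m) * t)                     ≡⟨ lemma m t ⟩
      3 * (m * t) + 2 * (3 * t)             ≡⟨ cong (_+ 2 * (3 * t)) y-degree-sum ⟩
      bipartite + 2 * (3 * t)               ∎))
      where
      lemma : ∀ m t → 3 * ((2 + m) * t) ≡ 3 * (m * t) + 2 * (3 * t)
      lemma = solve-∀

    -- An edge shared with `triangle i` is some `xx j i`, and its term alone is 1.
    hit : ∀ i → 1 ≤ ∑[ j < 3 ] μ (xx j i)
    hit i =
      let e , e∈      = All.tabulate⁻ hits i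
          e∈F , e∈T   = x∈p∩q⁻ (edges F) (edges (triangle i)) e∈
          j , e≡xx    = ∈-triangleE i e∈T
      in ≤-trans (≤-reflexive (sym (multiplicity-∈ F (subst (_∈ edges F) e≡xx e∈F))))
                 (term≤sum (λ j → μ (xx j i)) j)

    r≤3t : r ≤ 3 * t
    r≤3t = ≤R.begin
      r                                ≤R.≡⟨ trans (sum-const r 1) (*-identityʳ r) ⟨
      ∑[ i < r ] 1                     ≤R.≤⟨ sum-mono hit ⟩
      -- Grouped by triangle the sum has `r` positive terms; grouped by copy it is `triangular`.
      ∑[ i < r ] ∑[ j < 3 ] μ (xx j i) ≤R.≡⟨ ∑-comm (λ i j → μ (xx j i)) ⟩
      triangular                       ≤R.≡⟨ triangular≡3t ⟩
      3 * t                            ≤R.∎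
      where module ≤R = ≤-Reasoning

-- Vertex connectivity.

module _ (k : ℕ) where

  private
    -- Here `m` is positive, so every copy has a vertex `y j 0F` for the detours in `x⇝hub`.
    m r : ℕ
    m = 1 + k
    r = 2 + m

  open Construction r m

  module _ (S : Subset (order G)) (∣S∣<r : ∣ S ∣ < r) where

    private
      _⇝_ : Vertex G → Vertex G → Set
      _⇝_ = Star (Adjacent (G ∖ S))

      step : ∀ {u v} e → ends G e ≡ (u , v) → u ∉ S → v ∉ S → Adjacent (G ∖ S) u v
      step = ∖-adjacent {G} {S}

      back : ∀ {u v} → Adjacent (G ∖ S) u v → Adjacent (G ∖ S) v u
      back = Adjacent-sym (G ∖ S)

    intactTriangle : ∃[ i ] (∀ j → x j i ∉ S)
    intactTriangle = map₂ (λ {i} unused j → unused (cong (colour ∘ proj₂) (decodeV-x j i)))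
                          (unusedColour (colour ∘ proj₂ ∘ decodeV) S ∣S∣<r)
      where
      colour : Fin r ⊎ Fin m → Fin r
      colour (inj₁ i) = i
      -- An arbitrary default: a deleted `y`-vertex can only spoil colour `0F`, and `S` still has
      -- fewer members than there are colours.
      colour (inj₂ _) = 0F

    private
      i₀ = proj₁ intactTriangle
      hub = x 0F i₀

      xi₀∉S : ∀ j → x j i₀ ∉ S
      xi₀∉S = proj₂ intactTriangle

    triangle⇝hub : ∀ j → x j i₀ ⇝ hub
    triangle⇝hub 0F = ε
    triangle⇝hub 1F = back (step (xx 0F i₀) (ends-xx 0F i₀) (xi₀∉S 0F) (xi₀∉S 1F)) ◅ ε
    triangle⇝hub 2F = step (xx 2F i₀) (ends-xx 2F i₀) (xi₀∉S 2F) (xi₀∉S 0F) ◅ ε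

    -- The intact triangle has a vertex in every copy, adjacent to all `y`-vertices of that copy.
    y⇝hub : ∀ j l → y j l ∉ S → y j l ⇝ hub
    y⇝hub j l y∉S =
      back (step (xy j i₀ l) (ends-xy j i₀ l) (xi₀∉S j) y∉S) ◅ triangle⇝hub j

    x⇝hub-via-y : ∀ j i l → x j i ∉ S → y j l ∉ S → x j i ⇝ hub
    x⇝hub-via-y j i l x∉S y∉S = step (xy j i l) (ends-xy j i l) x∉S y∉S ◅ y⇝hub j l y∉S

    -- `offset j j′` is `j′ - j` modulo 3, the position of copy `j′` as seen from copy `j`.
    offset : Fin 3 → Fin 3 → Fin 3
    offset 0F = λ j → j
    offset 1F = prev
    offset 2F = next

    offset-self : ∀ j → offset j j ≡ 0F
    offset-self 0F = refl
    offset-self 1F = refl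
    offset-self 2F = refl

    offset-next : ∀ j → offset j (next j) ≡ 1F
    offset-next 0F = refl
    offset-next 1F = refl
    offset-next 2F = refl

    offset-prev : ∀ j → offset j (prev j) ≡ 2F
    offset-prev 0F = refl
    offset-prev 1F = refl
    offset-prev 2F = refl

    -- With the copy of x j i at offset 0, the r = m + 2 colour classes separate the
    -- m vertices y j l from one another and from the other two copies, so that each
    -- missed colour yields a route from x j i to the hub.
    colour : Fin 3 → Fin r ⊎ Fin m → Fin r
    colour 0F (inj₁ _) = 0F
    colour 0F (inj₂ l) = suc (suc l)
    colour 1F _        = 0F
    colour 2F _        = 1F

    colourFrom : Fin 3 → Vertex G → Fin r
    colourFrom j v = let j′ , w = decodeV v in colour (offset j j′) w

    colourFrom≡ : ∀ j v {j′ w o} → decodeV v ≡ (j′ , w) → offset j j′ ≡ o → colourFrom j v ≡ colour o w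
    colourFrom≡ j v {w = w} eq offset≡ =
      trans (cong (λ (j′ , w) → colour (offset j j′) w) eq) (cong (λ o → colour o w) offset≡)

    -- The colour missed by `S` selects the route: through the next copy, through the previous copy,
    -- or through a `y`-vertex of the same copy.
    x⇝hub : ∀ j i → x j i ∉ S → x j i ⇝ hub
    x⇝hub j i x∉S with unusedColour (colourFrom j) S ∣S∣<r
    -- All of copy `next j` has colour `0F` and so survives: cross along the triangle edge and
    -- continue through a `y`-vertex there.
    ... | 0F , unused =
      step (xx j i) (ends-xx j i) x∉S x′∉S ◅ x⇝hub-via-y (next j) i 0F x′∉S y′∉S
      where
      x′∉S = unused {x (next j) i} (colourFrom≡ j (x (next j) i) (decodeV-x (next j) i) (offset-next j))
      y′∉S = unused {y (next j) 0F} (colourFrom≡ j (y (next j) 0F) (decodeV-y (next j) 0F) (offset-next j))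
    ... | 1F , unused =
      -- The triangle edge from the intact copy `prev j` leads into copy `j`, so it is traversed
      -- backwards.
      back (step (xx (prev j) i) ends≡ x′∉S x∉S) ◅ x⇝hub-via-y (prev j) i 0F x′∉S y′∉S
      where
      ends≡ = trans (ends-xx (prev j) i) (cong (λ j′ → x (prev j) i , x j′ i) (next-prev j))
      x′∉S = unused {x (prev j) i} (colourFrom≡ j (x (prev j) i) (decodeV-x (prev j) i) (offset-prev j))
      y′∉S = unused {y (prev j) 0F} (colourFrom≡ j (y (prev j) 0F) (decodeV-y (prev j) 0F) (offset-prev j))
    -- This colour belongs to `y j l` alone, which therefore survives.
    ... | suc (suc l) , unused =
      x⇝hub-via-y j i l x∉S (unused {y j l} (colourFrom≡ j (y j l) (decodeV-y j l) (offset-self j)))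

    ∖-connected : Connected (G ∖ S)
    ∖-connected = connected-via (G ∖ S) hub (x∉p⇒x∈∁p (xi₀∉S 0F)) λ v∈ → path (viewV _) (x∈∁p⇒x∉p v∈)
      where
      path : ∀ {v} → ViewV v → v ∉ S → v ⇝ hub
      path (isX j i) = x⇝hub j i
      path (isY j l) = y⇝hub j l

  vertexConnected : VertexConnected r G
  -- A single copy already has `r + m` vertices, more than `r` since `m` is positive.
  vertexConnected = ≤-trans (m<m+n r (s≤s z≤n)) (m≤m+n (r + m) _) , ∖-connected

theorem3p1 : ∀ (r : ℕ) → r ≥ 3 →
    Σ[ G ∈ Graph ] Σ[ 𝒪 ∈ List (Subgraph G) ]
    ( VertexConnected r G
    × RegularGraph r G
    × 2 ∣ order G
    × All OddCycle 𝒪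
    × AllPairs VertexDisjoint 𝒪
    × (∀ (t : ℕ) (F : Subgraph G) → t ≥ 1 → Factor t F →
    All (ShareEdge F) 𝒪 → 3 * t ≥ r) )
-- Writing `r` as `3 + k` gives `m = 1 + k`, for which `r ≡ 2 + m` holds by computation.
theorem3p1 (suc (suc (suc k))) (s≤s (s≤s (s≤s _))) =
  G , triangles , vertexConnected k , regular refl , order-even refl ,
  triangles-odd , triangles-pairwise-disjoint ,
  λ t F _ factor hits → r≤3t refl t F factor hits
  where open Construction (3 + k) (1 + k)
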